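{- Let $F$ be a field, let $G$ be a bipartite graph on $n$ vertices, and let $k\ge 2$ be an integer. If $\mathcal{I}_F(G)\neq\emptyset$, then $$f(G\Box C_{2k})=n.$$
   Context: All graphs are finite and simple. For a graph $H$ with a perfect matching $M$, a subset $S\subseteq M$ is a forcing set of $M$ if $S$ is contained in no other perfect matching of $H$; the forcing number $f(H,M)$ is the minimum size of a forcing set of $M$, and the minimum forcing number $f(H)$ is the minimum of $f(H,M)$ over all perfect matchings $M$ of $H$. A weighted adjacency matrix of a graph $G$ over a field $F$ is a matrix over $F$ with rows and columns indexed by $V(G)$ whose $(u,v)$ entry is nonzero if and only if $u$ and $v$ are adjacent in $G$. A matrix $A$ is involutory if $A^{ -1}=A$ (i.e. $A^2=I$). $\mathcal{I}_F(G)$ denotes the set of weighted adjacency matrices of $G$ over $F$ that are involutory. $C_{2k}$ is the cycle on $2k$ vertices. The Cartesian product $G\Box H$ has vertex set $V(G)\times V(H)$, with $(g_1,h_1)$ and $(g_2,h_2)$ adjacent iff either $g_1=g_2$ and $h_1h_2\in E(H)$, or $h_1=h_2$ and $g_1g_2\in E(G)$. -}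

module Defs where

open import Algebra.Apartness.Bundles using (HeytingField; HeytingCommutativeRing)
open import Algebra.Bundles using (CommutativeRing)
import Algebra.Properties.Semiring.Sum as SemiringSum
open import Data.Bool.Base using (Bool; if_then_else_)
open import Data.Fin.Base using (Fin; toℕ; remQuot)
open import Data.Fin.Properties using () renaming (_≟_ to _≟ᶠ_; _<?_ to _<ᶠ?_)
open import Data.Fin.Subset using (Subset; _∈_; _⊆_; ∣_∣)
open import Data.List.Base using (List; length; lookup; filter; cartesianProduct; allFin)
open import Data.Nat.Base using (ℕ; suc; _*_; _≤_; s≤s)
open import Data.Nat.Properties using (_≟_; ≤-trans; *-monoʳ-≤; n≤1+n; 1+n≢n)
open import Data.Product.Base using (_×_; _,_; proj₁; proj₂; ∃; ∃-syntax)
open import Data.Product using (∃!)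
open import Data.Sum.Base using (_⊎_; inj₁; inj₂; swap)
open import Function.Bundles using (_⇔_)
open import Level using (0ℓ)
open import Relation.Binary.Core using (Rel)
open import Relation.Binary.Definitions using (Decidable; Symmetric)
open import Relation.Binary.PropositionalEquality using (_≡_; _≢_; refl; sym; trans; cong)
open import Relation.Nullary using (¬_; does)
open import Relation.Nullary.Decidable using (_×-dec_; _⊎-dec_)

------------------------------------------------------------------------
-- Finite simple graphs

record Graph (n : ℕ) : Set₁ where
  field
    Adj    : Rel (Fin n) 0ℓ
    adj?   : Decidable Adj
    symm   : Symmetric Adj
    irrefl : ∀ v → ¬ Adj v v

open Graph public

Bipartite : ∀ {n} → Graph n → Set
Bipartite {n} G =
  ∃ λ (side : Fin n → Bool) → ∀ u v → Adj G u v → side u ≢ side v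

-- The vertices of G □ H are the pairs in Fin m × Fin n, coded as elements of
-- Fin (m * n) through the bijection remQuot n (with inverse combine).

module _ {m n : ℕ} (G : Graph m) (H : Graph n) where

  □-Adj : Rel (Fin m × Fin n) 0ℓ
  □-Adj (g₁ , h₁) (g₂ , h₂) =
    (g₁ ≡ g₂ × Adj H h₁ h₂) ⊎ (h₁ ≡ h₂ × Adj G g₁ g₂)

  infixr 7 _□_

  _□_ : Graph (m * n)
  _□_ = record
    { Adj    = λ x y → □-Adj (remQuot n x) (remQuot n y)
    ; adj?   = λ x y → dec (remQuot n x) (remQuot n y)
    ; symm   = λ { (inj₁ (e , a)) → inj₁ (sym e , symm H a)
                 ; (inj₂ (e , a)) → inj₂ (sym e , symm G a) }
    ; irrefl = λ { _ (inj₁ (_ , a)) → irrefl H _ a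
                 ; _ (inj₂ (_ , a)) → irrefl G _ a }
    }
    where
    dec : Decidable □-Adj
    dec (g₁ , h₁) (g₂ , h₂) =
      ((g₁ ≟ᶠ g₂) ×-dec adj? H h₁ h₂) ⊎-dec ((h₁ ≟ᶠ h₂) ×-dec adj? G g₁ g₂)

-- Next i j says that j is the cyclic successor of i, i.e. j = i + 1 mod m.

Next : ∀ {m} → Rel (Fin m) 0ℓ
Next {m} i j = (toℕ j ≡ suc (toℕ i)) ⊎ (suc (toℕ i) ≡ m × toℕ j ≡ 0)

next? : ∀ {m} → Decidable (Next {m})
next? {m} i j =
  (toℕ j ≟ suc (toℕ i)) ⊎-dec ((suc (toℕ i) ≟ m) ×-dec (toℕ j ≟ 0))

next-irrefl : ∀ {m} → 3 ≤ m → (i : Fin m) → ¬ Next i i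
next-irrefl _         i (inj₁ e)        = 1+n≢n (sym e)
next-irrefl 3≤m       i (inj₂ (e , z)) with trans (sym (cong suc z)) e
next-irrefl (s≤s ()) i (inj₂ (e , z)) | refl

cycle : (m : ℕ) → 3 ≤ m → Graph m
cycle m 3≤m = record
  { Adj    = λ i j → Next i j ⊎ Next j i
  ; adj?   = λ i j → next? i j ⊎-dec next? j i
  ; symm   = swap
  ; irrefl = λ { i (inj₁ p) → next-irrefl 3≤m i p
               ; i (inj₂ p) → next-irrefl 3≤m i p }
  }

3≤2* : ∀ {k} → 2 ≤ k → 3 ≤ 2 * k
3≤2* 2≤k = ≤-trans (n≤1+n 3) (*-monoʳ-≤ 2 2≤k)

------------------------------------------------------------------------
-- Perfect matchings and forcing numbers

-- Each edge {u , v} is listed exactly once, as the pair (u , v) with u < v.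

edges : ∀ {n} → Graph n → List (Fin n × Fin n)
edges {n} G =
  filter (λ (u , v) → (u <ᶠ? v) ×-dec adj? G u v)
         (cartesianProduct (allFin n) (allFin n))

Edge : ∀ {n} → Graph n → Set
Edge G = Fin (length (edges G))

EdgeSet : ∀ {n} → Graph n → Set
EdgeSet G = Subset (length (edges G))

module _ {n : ℕ} (G : Graph n) where

  Incident : Fin n → Edge G → Set
  Incident v e = v ≡ proj₁ (lookup (edges G) e) ⊎ v ≡ proj₂ (lookup (edges G) e)

  PerfectMatching : EdgeSet G → Set
  PerfectMatching M = ∀ v → ∃! _≡_ (λ e → e ∈ M × Incident v e)

  ForcingSet : (M S : EdgeSet G) → Set
  ForcingSet M S = S ⊆ M × (∀ M′ → PerfectMatching M′ → S ⊆ M′ → M′ ≡ M)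

IsMinimum : (ℕ → Set) → ℕ → Set
IsMinimum P m = P m × (∀ j → P j → m ≤ j)

-- IsForcingNumber G M m is f(G,M) = m, and IsMinForcingNumber G m is f(G) = m.
-- They are relations because f(G) is undefined if G has no perfect matching.

IsForcingNumber : ∀ {n} (G : Graph n) → EdgeSet G → ℕ → Set
IsForcingNumber G M = IsMinimum (λ j → ∃[ S ] (ForcingSet G M S × ∣ S ∣ ≡ j))

IsMinForcingNumber : ∀ {n} → Graph n → ℕ → Set
IsMinForcingNumber G =
  IsMinimum (λ j → ∃[ M ] (PerfectMatching G M × IsForcingNumber G M j))

------------------------------------------------------------------------
-- Involutory weighted adjacency matrices

-- In a Heyting field _#_ is a tight apartness, and x is invertible iff x # 0;
-- classically this is exactly a field, with _#_ the negation of _≈_.  "Nonzero"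
-- below is the negation of _≈_, which constructively is the weaker condition.

module _ {c ℓ₁ ℓ₂} (F : HeytingField c ℓ₁ ℓ₂) where

  open HeytingField F using (Carrier; _≈_; 0#; 1#; heytingCommutativeRing)
    renaming (_*_ to _·_)
  open HeytingCommutativeRing heytingCommutativeRing using (commutativeRing)
  open SemiringSum (CommutativeRing.semiring commutativeRing) using (sum)

  Matrix : ℕ → Set c
  Matrix n = Fin n → Fin n → Carrier

  WeightedAdjacency : ∀ {n} → Graph n → Matrix n → Set ℓ₁
  WeightedAdjacency G A = ∀ u v → (¬ (A u v ≈ 0#)) ⇔ Adj G u v

  _⊗_ : ∀ {n} → Matrix n → Matrix n → Matrix n
  (A ⊗ B) u v = sum (λ w → A u w · B w v)

  identity : ∀ {n} → Matrix n
  identity u v = if does (u ≟ᶠ v) then 1# else 0#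

  Involutory : ∀ {n} → Matrix n → Set ℓ₁
  Involutory A = ∀ u v → (A ⊗ A) u v ≈ identity u v

  𝓘 : ∀ {n} → Graph n → Matrix n → Set ℓ₁
  𝓘 G A = WeightedAdjacency G A × Involutory A

{-# OPTIONS --safe #-}

-- Lower bound.  A kernel vector of a weighted adjacency matrix of H = G □ C₂ₖ that
-- vanishes at the ends of a forcing set vanishes everywhere: otherwise its support
-- carries a cycle alternating with respect to the matching and avoiding the forcing
-- set.  Since a forcing set S has 2 ∣S∣ ends, n ≤ ∣S∣ follows from a kernel of rank
-- 2 n.  If A² = 1 then x (u , i) = (Aⁱ y_i) u lies in such a kernel as soon as
-- consecutive triples of layers satisfy a linear relation α y_(i-1) + β y_i +
-- γ y_(i+1) = 0 with units α, β, γ.  This holds when each y_i is one of p, q, p + q,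
-- p + t q, with free vectors p and q and with t and t − 1 invertible, and the choices
-- on any three consecutive layers are distinct, that is, for a proper 4-colouring of
-- the square of C₂ₖ.
--
-- Upper bound.  Match (v , i) with (v , i ± 1), the sign given by the bipartition
-- class of (v , i); the n matching edges that meet layer 0 form a forcing set.

module Submission where

open import Defs
open import Algebra.Apartness.Bundles using (HeytingField; HeytingCommutativeRing)
import Algebra.Apartness.Properties.HeytingCommutativeRing as HCRProperties
open import Algebra.Bundles using (CommutativeRing)
import Algebra.Properties.Ring as RingProperties
import Algebra.Properties.Semiring.Sum as SemiringSum
open import Data.Bool.Base using (Bool; true; false; not; _xor_; if_then_else_)
open import Data.Bool.Properties as Bool using (¬-not; not-¬; not-involutive; not-distribʳ-xor; not-distribˡ-xor)
open import Data.Fin.Base using (Fin; zero; suc; toℕ; fromℕ; fromℕ<; inject₁; combine; remQuot; punchIn; _<_)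
open import Data.Fin.Patterns using (0F; 1F; 2F; 3F)
open import Data.Fin.Properties using (_≟_; _<?_; <-cmp; <-asym; any?; pigeonhole; sequence; punchInᵢ≢i; toℕ-injective; toℕ<n; toℕ-fromℕ; toℕ-fromℕ<; toℕ-inject₁; remQuot-combine; combine-remQuot; combine-injectiveʳ)
open import Data.Fin.Subset using (Subset; _∈_; _⊆_; ∣_∣; ⋃; ⁅_⁆; _∪_; inside; outside)
open import Data.Fin.Subset.Properties using (⊆-antisym; ∪-identityˡ; x∈⁅x⁆; x∈⁅y⁆⇒x≡y; x∈p∪q⁻; x∈p∪q⁺; ∉⊥; ∣⊥∣≡0)
open import Data.List.Base as List using (List; []; _∷_; length; lookup; map; cartesianProduct; allFin)
open import Data.List.Membership.Propositional using () renaming (_∈_ to _∈ˡ_)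
open import Data.List.Membership.Propositional.Properties using (∈-filter⁺; ∈-filter⁻; ∈-cartesianProduct⁺; ∈-allFin; ∈-lookup; ∈-map⁺; ∈-tabulate⁺; ∈-tabulate⁻)
open import Data.List.Properties using (length-map; length-tabulate)
open import Data.List.Relation.Unary.All as All using (All; []; _∷_)
import Data.List.Relation.Unary.All.Properties as All
open import Data.List.Relation.Unary.AllPairs using ([]; _∷_)
open import Data.List.Relation.Unary.Any using (here; there; index)
open import Data.List.Relation.Unary.Any.Properties using (lookup-index)
open import Data.List.Relation.Unary.Unique.Propositional using (Unique)
import Data.List.Relation.Unary.Unique.Propositional.Properties as Unique
open import Data.Nat.Base as ℕ using (ℕ; zero; suc; z≤n; s≤s)
open import Data.Nat.GeneralisedArithmetic using (fold)
import Data.Nat.Properties as ℕ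
open import Data.Nat.Tactic.RingSolver using (solve-∀)
open import Data.Product.Base using (_×_; _,_; proj₁; proj₂; ∃)
open import Data.Sum.Base using (_⊎_; inj₁; inj₂; swap; [_,_]′)
open import Data.Vec.Base using ([]; _∷_; here; there; tabulate)
open import Data.Vec.Functional using (Vector; insertAt)
open import Data.Vec.Functional.Properties using (insertAt-lookup; insertAt-punchIn)
open import Data.Vec.Properties using (lookup∘tabulate; lookup⇒[]=; []=⇒lookup)
open import Effect.Monad using (RawMonad)
open import Function.Base using (_∘_)
open import Function.Bundles using (Equivalence)
open import Level using (0ℓ; _⊔_)
open import Relation.Binary.Definitions using (tri<; tri≈; tri>)
open import Relation.Binary.PropositionalEquality using (_≡_; _≢_; refl; sym; trans; cong; cong₂; subst; module ≡-Reasoning)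
import Relation.Binary.Reasoning.Setoid as SetoidReasoning
open import Relation.Nullary using (¬_; Dec; yes; no; does; contradiction)
open import Relation.Nullary.Decidable using (_×-dec_; ¬?; decidable-stable; dec-true; dec-false; ¬¬-excluded-middle)
open import Relation.Nullary.Negation using (¬¬-Monad)
open import Relation.Unary using (Pred; Decidable)

-- Lists without repetition and iteration of a map

lookup-injective : ∀ {a} {A : Set a} {xs : List A} → Unique xs →
  ∀ {i j} → lookup xs i ≡ lookup xs j → i ≡ j
lookup-injective (_ ∷ _)   {zero}  {zero}  _  = refl
lookup-injective (x∉ ∷ _)  {zero}  {suc j} eq = contradiction eq (All.lookup x∉ (∈-lookup j))
lookup-injective (x∉ ∷ _)  {suc i} {zero}  eq = contradiction (sym eq) (All.lookup x∉ (∈-lookup i))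
lookup-injective (_ ∷ uxs) {suc i} {suc j} eq = cong suc (lookup-injective uxs eq)

fold-suc : ∀ {a} {A : Set a} (f : A → A) x m → fold (f x) f m ≡ fold x f (suc m)
fold-suc f x zero    = refl
fold-suc f x (suc m) = cong f (fold-suc f x m)

fold-+ : ∀ {a} {A : Set a} (f : A → A) x m l → fold (fold x f l) f m ≡ fold x f (m ℕ.+ l)
fold-+ f x zero    l = refl
fold-+ f x (suc m) l = cong f (fold-+ f x m l)

-- Two of the iterates with exponents 0 to `m` coincide. As `f` may fail to be injective, an initial
-- stretch of length `l` can precede the cycle.
periodic-point : ∀ {m} (f : Fin m → Fin m) (x : Fin m) →
  ∃ λ l → ∃ λ p → fold (fold x f l) f (suc p) ≡ fold x f l
periodic-point {m} f x with pigeonhole (ℕ.n<1+n m) (fold x f ∘ toℕ)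
... | i , j , i<j , eq with ℕ.m≤n⇒∃[o]m+o≡n i<j
...   | o , i+o≡j = toℕ i , o , (begin
  fold (fold x f (toℕ i)) f (suc o) ≡⟨ fold-+ f x (suc o) (toℕ i) ⟩
  fold x f (suc o ℕ.+ toℕ i)        ≡⟨ cong (fold x f) (trans (cong suc (ℕ.+-comm o (toℕ i))) i+o≡j) ⟩
  fold x f (toℕ j)                  ≡⟨ eq ⟨
  fold x f (toℕ i)                  ∎)
  where open ≡-Reasoning

≢≢⇒≡ : ∀ {a b c : Bool} → a ≢ b → a ≢ c → b ≡ c
≢≢⇒≡ a≢b a≢c = trans (¬-not (a≢b ∘ sym)) (sym (¬-not (a≢c ∘ sym)))

-- Perfect matchings as involutions, and alternating cycles

module Matchings {N : ℕ} (H : Graph N) where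

  -- The edge list stores the smaller end first; `Joins` forgets this orientation.
  Joins : Edge H → Fin N → Fin N → Set
  Joins e u v = lookup (edges H) e ≡ (u , v) ⊎ lookup (edges H) e ≡ (v , u)

  private
    Ordered : Pred (Fin N × Fin N) 0ℓ
    Ordered (u , v) = u < v × Adj H u v

    ordered? : Decidable Ordered
    ordered? (u , v) = (u <? v) ×-dec adj? H u v

    pairs : List (Fin N × Fin N)
    pairs = cartesianProduct (allFin N) (allFin N)

    edge-ordered : ∀ e → Ordered (lookup (edges H) e)
    edge-ordered e = proj₂ (∈-filter⁻ ordered? {xs = pairs} (∈-lookup e))

    edge-at : ∀ {u v} → Ordered (u , v) → ∃ λ e → lookup (edges H) e ≡ (u , v)
    edge-at {u} {v} o = index uv∈ , sym (lookup-index uv∈)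
      where uv∈ = ∈-filter⁺ ordered? (∈-cartesianProduct⁺ (∈-allFin u) (∈-allFin v)) o

    edges-unique : Unique (edges H)
    edges-unique = Unique.filter⁺ ordered?
      (Unique.cartesianProduct⁺ (Unique.allFin⁺ N) (Unique.allFin⁺ N))

    edges-asym : ∀ {e e′ u v} → lookup (edges H) e ≡ (u , v) → lookup (edges H) e′ ≢ (v , u)
    edges-asym {e} {e′} p q = <-asym (proj₁ (subst Ordered p (edge-ordered e)))
                                     (proj₁ (subst Ordered q (edge-ordered e′)))

  joins⇒adj : ∀ {e u v} → Joins e u v → Adj H u v
  joins⇒adj {e} (inj₁ p) = proj₂ (subst Ordered p (edge-ordered e))
  joins⇒adj {e} (inj₂ p) = symm H (proj₂ (subst Ordered p (edge-ordered e)))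

  adj⇒joins : ∀ {u v} → Adj H u v → ∃ λ e → Joins e u v
  adj⇒joins {u} {v} a with <-cmp u v
  ... | tri< u<v _ _ = let e , p = edge-at (u<v , a) in e , inj₁ p
  ... | tri> _ _ v<u = let e , p = edge-at (v<u , symm H a) in e , inj₂ p
  ... | tri≈ _ refl _ = contradiction a (irrefl H u)

  joins-injective : ∀ {e e′ u v} → Joins e u v → Joins e′ u v → e ≡ e′
  joins-injective (inj₁ p) (inj₁ q) = lookup-injective edges-unique (trans p (sym q))
  joins-injective (inj₂ p) (inj₂ q) = lookup-injective edges-unique (trans p (sym q))
  joins-injective (inj₁ p) (inj₂ q) = contradiction q (edges-asym p)
  joins-injective (inj₂ p) (inj₁ q) = contradiction q (edges-asym p)

  joins-functional : ∀ {e u v w} → Joins e u v → Joins e u w → v ≡ w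
  joins-functional (inj₁ p) (inj₁ q) = cong proj₂ (trans (sym p) q)
  joins-functional (inj₂ p) (inj₂ q) = cong proj₁ (trans (sym p) q)
  joins-functional (inj₁ p) (inj₂ q) with refl ← trans (sym p) q = refl
  joins-functional (inj₂ p) (inj₁ q) with refl ← trans (sym p) q = refl

  joins⇒incident : ∀ {e u v} → Joins e u v → Incident H u e
  joins⇒incident (inj₁ p) = inj₁ (sym (cong proj₁ p))
  joins⇒incident (inj₂ p) = inj₂ (sym (cong proj₂ p))

  incident⇒joins : ∀ {e u} → Incident H u e → ∃ λ v → Joins e u v
  incident⇒joins (inj₁ refl) = _ , inj₁ refl
  incident⇒joins (inj₂ refl) = _ , inj₂ refl

  joins-ends : ∀ e → Joins e (proj₁ (lookup (edges H) e)) (proj₂ (lookup (edges H) e))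
  joins-ends e = inj₁ refl

  module Partner (M : EdgeSet H) (pm : PerfectMatching H M) where

    private
      matching-edge : Fin N → Edge H
      matching-edge v = proj₁ (pm v)

    partner : Fin N → Fin N
    partner v = proj₁ (incident⇒joins (proj₂ (proj₁ (proj₂ (pm v)))))

    partner-edge : ∀ v → ∃ λ e → e ∈ M × Joins e v (partner v)
    partner-edge v = matching-edge v , proj₁ (proj₁ (proj₂ (pm v))) ,
      proj₂ (incident⇒joins (proj₂ (proj₁ (proj₂ (pm v)))))

    partner-adj : ∀ v → Adj H v (partner v)
    partner-adj v = joins⇒adj (proj₂ (proj₂ (partner-edge v)))

    partner-unique : ∀ {e u v} → e ∈ M → Joins e u v → partner u ≡ v
    partner-unique {e} {u} e∈M j with proj₂ (proj₂ (pm u)) (e∈M , joins⇒incident j)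
    ... | refl = joins-functional (proj₂ (proj₂ (partner-edge u))) j

    partner-involutive : ∀ v → partner (partner v) ≡ v
    partner-involutive v = let e , e∈M , j = partner-edge v in partner-unique e∈M (swap j)

    partner⇒∈ : ∀ {e u v} → Joins e u v → partner u ≡ v → e ∈ M
    partner⇒∈ {u = u} j refl = let e , e∈M , j′ = partner-edge u in
      subst (_∈ M) (joins-injective j′ j) e∈M

  -- Converse to `Partner`: rematching can be carried out on involutions and translated back to edge
  -- sets.
  module OfInvolution (ν : Fin N → Fin N) (ν-adj : ∀ v → Adj H v (ν v))
                      (ν-involutive : ∀ v → ν (ν v) ≡ v) where

    private
      member? : (e : Edge H) → Dec (ν (proj₁ (lookup (edges H) e)) ≡ proj₂ (lookup (edges H) e))
      member? e = ν (proj₁ (lookup (edges H) e)) ≟ proj₂ (lookup (edges H) e)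

    matching : EdgeSet H
    matching = tabulate (does ∘ member?)

    ∈⇒ν : ∀ {e u v} → e ∈ matching → Joins e u v → ν u ≡ v
    ∈⇒ν {e} e∈ j with member? e | trans (sym (lookup∘tabulate (does ∘ member?) e)) ([]=⇒lookup e∈)
    ∈⇒ν e∈ (inj₁ refl) | yes p | _ = p
    ∈⇒ν e∈ (inj₂ refl) | yes p | _ = trans (cong ν (sym p)) (ν-involutive _)

    ν⇒∈ : ∀ {e u v} → Joins e u v → ν u ≡ v → e ∈ matching
    ν⇒∈ {e} j eq = lookup⇒[]= e matching
      (trans (lookup∘tabulate (does ∘ member?) e) (dec-true (member? e) (oriented j eq)))
      where
      oriented : ∀ {u v} → Joins e u v → ν u ≡ v → ν (proj₁ (lookup (edges H) e)) ≡ proj₂ (lookup (edges H) e)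
      oriented (inj₁ refl) eq = eq
      oriented (inj₂ refl) eq = trans (cong ν (sym eq)) (ν-involutive _)

    edge-of : ∀ v → ∃ λ e → Joins e v (ν v)
    edge-of v = adj⇒joins (ν-adj v)

    matching-perfect : PerfectMatching H matching
    matching-perfect v = let e , j = edge-of v in
      e , (ν⇒∈ j refl , joins⇒incident j) , λ { (e′∈ , inc) →
        let w , j′ = incident⇒joins inc in
        joins-injective j (subst (Joins _ v) (sym (∈⇒ν e′∈ j′)) j′) }

  matching-unique : ∀ (ν : Fin N → Fin N) ν-adj ν-inv M (pm : PerfectMatching H M) →
    (∀ v → Partner.partner M pm v ≡ ν v) → M ≡ OfInvolution.matching ν ν-adj ν-inv
  matching-unique ν ν-adj ν-inv M pm agree = ⊆-antisym
    (λ {e} e∈M → ν⇒∈ (joins-ends e) (trans (sym (agree _)) (partner-unique e∈M (joins-ends e))))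
    (λ {e} e∈ → partner⇒∈ (joins-ends e) (trans (agree _) (∈⇒ν e∈ (joins-ends e))))
    where
    open OfInvolution ν ν-adj ν-inv
    open Partner M pm

  -- Exchanges the matching along alternating cycles a, partner a, φ a,
  -- partner (φ a), …: each partner a is rematched to φ a.
  module Swap
    (M : EdgeSet H) (pm : PerfectMatching H M)
    {ℓ} {C : Pred (Fin N) ℓ} (C? : Decidable C)
    (partner∉C : ∀ {a} → C a → ¬ C (Partner.partner M pm a))
    (φ ψ : Fin N → Fin N)
    (φ∈C : ∀ {a} → C a → C (φ a)) (ψ∈C : ∀ {a} → C a → C (ψ a))
    (φψ : ∀ {a} → C a → φ (ψ a) ≡ a) (ψφ : ∀ {a} → C a → ψ (φ a) ≡ a)
    (φ-adj : ∀ {a} → C a → Adj H (Partner.partner M pm a) (φ a))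
    where

    open Partner M pm

    private
      branch : ∀ b → Dec (C b) → Dec (C (partner b)) → Fin N
      branch b (yes _) _       = partner (ψ b)
      branch b (no _)  (yes _) = φ (partner b)
      branch b (no _)  (no _)  = partner b

    swapped : Fin N → Fin N
    swapped b = branch b (C? b) (C? (partner b))

    swapped-C : ∀ {b} → C b → swapped b ≡ partner (ψ b)
    swapped-C {b} Cb with C? b
    ... | yes _  = refl
    ... | no ¬Cb = contradiction Cb ¬Cb

    swapped-partner : ∀ {a} → C a → swapped (partner a) ≡ φ a
    swapped-partner {a} Ca with C? (partner a) | C? (partner (partner a))
    ... | yes Cpa | _       = contradiction Cpa (partner∉C Ca)
    ... | no _    | yes _   = cong φ (partner-involutive a)
    ... | no _    | no ¬Cpp = contradiction (subst C (sym (partner-involutive a)) Ca) ¬Cpp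

    swapped-other : ∀ {b} → ¬ C b → ¬ C (partner b) → swapped b ≡ partner b
    swapped-other {b} ¬Cb ¬Cpb with C? b | C? (partner b)
    ... | yes Cb | _       = contradiction Cb ¬Cb
    ... | no _   | yes Cpb = contradiction Cpb ¬Cpb
    ... | no _   | no _    = refl

    private
      -- The index turns the vertex into `partner a` in the second case, so that `swapped-partner`
      -- applies to it directly.
      data View : Fin N → Set ℓ where
        inC      : ∀ {b} → C b → View b
        partnerC : ∀ {a} → C a → View (partner a)
        other    : ∀ {b} → ¬ C b → ¬ C (partner b) → View b

      view : ∀ b → View b
      view b with C? b | C? (partner b)
      ... | yes Cb | _       = inC Cb
      ... | no _   | yes Cpb = subst View (partner-involutive b) (partnerC Cpb)
      ... | no ¬Cb | no ¬Cpb = other ¬Cb ¬Cpb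

    swapped-involutive : ∀ b → swapped (swapped b) ≡ b
    swapped-involutive b with view b
    ... | inC Cb = trans (cong swapped (swapped-C Cb)) (trans (swapped-partner (ψ∈C Cb)) (φψ Cb))
    ... | partnerC Ca = trans (cong swapped (swapped-partner Ca))
      (trans (swapped-C (φ∈C Ca)) (cong partner (ψφ Ca)))
    ... | other ¬Cb ¬Cpb = trans (cong swapped (swapped-other ¬Cb ¬Cpb))
      (trans (swapped-other ¬Cpb (¬Cb ∘ subst C (partner-involutive b))) (partner-involutive b))

    swapped-adj : ∀ b → Adj H b (swapped b)
    swapped-adj b with view b
    ... | inC Cb = subst (Adj H b) (sym (swapped-C Cb))
      (symm H (subst (Adj H _) (φψ Cb) (φ-adj (ψ∈C Cb))))
    ... | partnerC Ca = subst (Adj H _) (sym (swapped-partner Ca)) (φ-adj Ca)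
    ... | other ¬Cb ¬Cpb = subst (Adj H b) (sym (swapped-other ¬Cb ¬Cpb)) (partner-adj b)

    open OfInvolution swapped swapped-adj swapped-involutive public

  -- X plays the role of the zero set of a kernel vector of a weighted adjacency
  -- matrix; for such a vector an equation all of whose terms but one vanish
  -- forces the remaining term to vanish, which is the hypothesis propagates.
  module _
    (bip : Bipartite H) {M S : EdgeSet H}
    (pm : PerfectMatching H M) (forcing : ForcingSet H M S)
    {ℓ} {X : Pred (Fin N) ℓ} (X? : Decidable X)
    (propagates : ∀ w a → Adj H w a → (∀ b → Adj H w b → b ≢ a → X b) → X a)
    (X-ends : ∀ {e u v} → e ∈ S → Joins e u v → X u)
    where

    open Partner M pm

    private
      side : Fin N → Bool
      side = proj₁ bip

      rival? : ∀ a → Dec (∃ λ b → Adj H (partner a) b × b ≢ a × ¬ X b)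
      rival? a = any? (λ b → adj? H (partner a) b ×-dec (¬? (b ≟ a) ×-dec ¬? (X? b)))

      -- In the equation at `partner a`, the term of `a` cannot be the only one that does not
      -- vanish: otherwise `propagates` would put `a` into `X`.
      rival : ∀ {a} → ¬ X a → ∃ λ b → Adj H (partner a) b × b ≢ a × ¬ X b
      rival {a} ¬Xa = decidable-stable (rival? a) λ none →
        ¬Xa (propagates (partner a) a (symm H (partner-adj a)) λ b adj b≢a →
          decidable-stable (X? b) λ ¬Xb → none (b , adj , b≢a , ¬Xb))

      pick : ∀ a → Dec (X a) → Fin N
      -- A dummy value that makes `φ` total; `φ` is only studied off `X`.
      pick a (yes _)  = a
      pick a (no ¬Xa) = proj₁ (rival ¬Xa)

      φ : Fin N → Fin N
      φ a = pick a (X? a)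

      φ-spec : ∀ {a} → ¬ X a → Adj H (partner a) (φ a) × φ a ≢ a × ¬ X (φ a)
      φ-spec {a} ¬Xa with X? a
      ... | yes Xa  = contradiction Xa ¬Xa
      ... | no ¬Xa′ = proj₂ (rival ¬Xa′)

      φ-side : ∀ {a} → ¬ X a → side (φ a) ≡ side a
      φ-side {a} ¬Xa = ≢≢⇒≡ (proj₂ bip _ _ (proj₁ (φ-spec ¬Xa)))
                            (proj₂ bip _ _ (symm H (partner-adj a)))

      -- Two steps in a bipartite graph return to the same side, so `φ` preserves it. Fixing the
      -- side keeps `a` and `partner a` from both being rematched as members of `C`, as `Swap`
      -- requires.
      Live : Bool → Fin N → Set ℓ
      Live s a = ¬ X a × side a ≡ s

      φ-live : ∀ {s a} → Live s a → Live s (φ a)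
      φ-live (¬Xa , sa) = proj₂ (proj₂ (φ-spec ¬Xa)) , trans (φ-side ¬Xa) sa

      iterate-live : ∀ {s a} m → Live s a → Live s (fold a φ m)
      iterate-live zero    la = la
      iterate-live (suc m) la = φ-live (iterate-live m la)

      module Alternating (s : Bool) (p : ℕ) where

        -- All live points whose period divides `suc p`, rather than a single orbit: this is
        -- decidable, and on it `φ` is a permutation with inverse its `p`-th iterate.
        C : Fin N → Set ℓ
        C a = Live s a × fold a φ (suc p) ≡ a

        C? : Decidable C
        C? a = (¬? (X? a) ×-dec (side a Bool.≟ s)) ×-dec (fold a φ (suc p) ≟ a)

        ψ : Fin N → Fin N
        ψ a = fold a φ p

        φ∈C : ∀ {a} → C a → C (φ a)
        φ∈C {a} (la , pa) = φ-live la , trans (fold-suc φ a (suc p)) (cong φ pa)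

        iterate∈C : ∀ {a} m → C a → C (fold a φ m)
        iterate∈C zero    Ca = Ca
        iterate∈C (suc m) Ca = φ∈C (iterate∈C m Ca)

        partner∉C : ∀ {a} → C a → ¬ C (partner a)
        partner∉C {a} ((_ , sa) , _) ((_ , sp) , _) =
          proj₂ bip a (partner a) (partner-adj a) (trans sa (sym sp))

        module Sw = Swap M pm C? partner∉C φ ψ φ∈C (iterate∈C p) proj₂
          (λ {a} Ca → trans (fold-suc φ a p) (proj₂ Ca))
          (λ Ca → proj₁ (φ-spec (proj₁ (proj₁ Ca))))

        -- The ends of the edges of `S` lie in `X` and `C` lies outside `X`, so the exchange leaves
        -- these edges alone.
        S⊆swapped : S ⊆ Sw.matching
        S⊆swapped {e} e∈S = Sw.ν⇒∈ (joins-ends e) (trans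
          (Sw.swapped-other (λ ((¬X , _) , _) → ¬X (X-ends e∈S (joins-ends e)))
                            (λ ((¬X , _) , _) → ¬X (subst X (sym pu) (X-ends e∈S (swap (joins-ends e))))))
          pu)
          where
          pu : partner (proj₁ (lookup (edges H) e)) ≡ proj₂ (lookup (edges H) e)
          pu = partner-unique (proj₁ forcing e∈S) (joins-ends e)

        -- The exchanged matching contains `S`, hence equals `M`. Comparing the partners of `φ c` in
        -- both gives `φ c ≡ c`, whereas a rival of `c` differs from `c`.
        C-empty : ∀ {c} → ¬ C c
        C-empty {c} Cc@((¬Xc , _) , _) = proj₁ (proj₂ (φ-spec ¬Xc)) φc≡c
          where
          new-edge : Sw.swapped (φ c) ≡ partner c
          new-edge = trans (Sw.swapped-C (φ∈C Cc))
            (cong partner (trans (fold-suc φ c p) (proj₂ Cc)))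

          old-edge : partner (φ c) ≡ partner c
          old-edge = let e , j = Sw.edge-of (φ c) in
            trans (partner-unique
              (subst (e ∈_) (proj₂ forcing Sw.matching Sw.matching-perfect S⊆swapped) (Sw.ν⇒∈ j refl)) j)
              new-edge

          φc≡c : φ c ≡ c
          φc≡c = trans (sym (partner-involutive (φ c))) (trans (cong partner old-edge) (partner-involutive c))

    -- Iterating `φ` from a vertex off `X` stays off `X` and eventually becomes periodic, which
    -- would make some `C` inhabited.
    forcing-set-spreads : ∀ a → X a
    forcing-set-spreads a = decidable-stable (X? a) λ ¬Xa →
      let l , p , periodic = periodic-point φ a
      in Alternating.C-empty (side a) p (iterate-live l (¬Xa , refl) , periodic)

-- Linear algebra over a Heyting field

module LinearAlgebra {c ℓ₁ ℓ₂} (F : HeytingField c ℓ₁ ℓ₂) where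

  open HeytingField F using (_#_; tight; #⇒invertible; heytingCommutativeRing)
  open HeytingCommutativeRing heytingCommutativeRing using (commutativeRing)
  open CommutativeRing commutativeRing hiding (zero)
    renaming (refl to ≈-refl; sym to ≈-sym; trans to ≈-trans)
  open HCRProperties heytingCommutativeRing using (1#0; x-0≈x)
  open RingProperties ring using (-‿distribʳ-*; -1*x≈-x)
  open SemiringSum semiring
    using (sum; sum-cong-≋; sum-remove; sum-replicate-zero; ∑-distrib-+; ∑-comm; *-distribˡ-sum; *-distribʳ-sum)
  open SetoidReasoning setoid

  -- By tightness, vanishing is itself a negation, that of apartness from zero.
  ≈0-stable : ∀ {x} → ¬ ¬ (x ≈ 0#) → x ≈ 0#
  ≈0-stable {x} ¬¬x≈0 = proj₁ (tight x 0#) λ x#0 → ¬¬x≈0 λ x≈0 → proj₂ (tight x 0#) x≈0 x#0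

  1≉0 : ¬ (1# ≈ 0#)
  1≉0 1≈0 = proj₂ (tight 1# 0#) 1≈0 1#0

  #0⇒inverse : ∀ {x} → x # 0# → ∃ λ y → x * y ≈ 1#
  #0⇒inverse {x} x#0 = let y , _ , xy≈1 = #⇒invertible x#0 in
    y , ≈-trans (*-congʳ (≈-sym (x-0≈x x))) xy≈1

  -- Being merely unequal to zero, `a` has no inverse at hand. If `x` were apart from zero,
  -- inverting `x` instead would make `a` vanish; tightness concludes.
  ≉0-cancelˡ : ∀ {a x} → ¬ (a ≈ 0#) → a * x ≈ 0# → x ≈ 0#
  ≉0-cancelˡ {a} {x} a≉0 ax≈0 = proj₁ (tight x 0#) λ x#0 →
    let y , xy≈1 = #0⇒inverse x#0 in a≉0 (begin
      a            ≈⟨ *-identityʳ a ⟨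
      a * 1#       ≈⟨ *-congˡ xy≈1 ⟨
      a * (x * y)  ≈⟨ *-assoc a x y ⟨
      (a * x) * y  ≈⟨ *-congʳ ax≈0 ⟩
      0# * y       ≈⟨ zeroˡ y ⟩
      0#           ∎)

  sum-≈0 : ∀ {n} (f : Vector Carrier n) → (∀ i → f i ≈ 0#) → sum f ≈ 0#
  sum-≈0 {n} f f≈0 = ≈-trans (sum-cong-≋ f≈0) (sum-replicate-zero n)

  sum-single : ∀ {n} (f : Vector Carrier n) i → (∀ j → j ≢ i → f j ≈ 0#) → sum f ≈ f i
  sum-single {suc n} f i off = begin
    sum f                             ≈⟨ sum-remove {i = i} f ⟩
    f i + sum (λ j → f (punchIn i j)) ≈⟨ +-congˡ (sum-≈0 _ λ j → off _ (punchInᵢ≢i i j)) ⟩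
    f i + 0#                          ≈⟨ +-identityʳ (f i) ⟩
    f i                               ∎

  infix 8 _∙_
  _∙_ : ∀ {n} → Vector Carrier n → Vector Carrier n → Carrier
  f ∙ g = sum (λ j → f j * g j)

  identity-∙ : ∀ {n} i (f : Vector Carrier n) → identity F i ∙ f ≈ f i
  identity-∙ i f = begin
    identity F i ∙ f   ≈⟨ sum-single _ i off ⟩
    identity F i i * f i ≈⟨ *-congʳ (reflexive (cong (if_then 1# else 0#) (dec-true (i ≟ i) refl))) ⟩
    1# * f i           ≈⟨ *-identityˡ (f i) ⟩
    f i                ∎
    where
    off : ∀ j → j ≢ i → identity F i j * f j ≈ 0#
    off j j≢i = ≈-trans
      (*-congʳ (reflexive (cong (if_then 1# else 0#) (dec-false (i ≟ j) (j≢i ∘ sym)))))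
      (zeroˡ (f j))

  ∙-assoc : ∀ {m n} (s : Vector Carrier m) (B : Fin m → Vector Carrier n) (f : Vector Carrier n) →
    s ∙ (λ i → B i ∙ f) ≈ (λ j → sum (λ i → s i * B i j)) ∙ f
  ∙-assoc {m} {n} s B f = begin
    sum (λ i → s i * sum (λ j → B i j * f j))     ≈⟨ sum-cong-≋ (λ i → *-distribˡ-sum {n} (s i) (λ j → B i j * f j)) ⟩
    sum (λ i → sum (λ j → s i * (B i j * f j)))   ≈⟨ ∑-comm {m} {n} (λ i j → s i * (B i j * f j)) ⟩
    sum (λ j → sum (λ i → s i * (B i j * f j)))   ≈⟨ sum-cong-≋ (λ j → sum-cong-≋ (λ i → *-assoc (s i) (B i j) (f j))) ⟨
    sum (λ j → sum (λ i → s i * B i j * f j))     ≈⟨ sum-cong-≋ (λ j → *-distribʳ-sum {m} (f j) (λ i → s i * B i j)) ⟨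
    sum (λ j → sum (λ i → s i * B i j) * f j)     ∎

  ∙-insertAt : ∀ {n} (s : Vector Carrier (suc n)) g i x →
    s ∙ insertAt g i x ≈ s i * x + (s ∘ punchIn i) ∙ g
  ∙-insertAt s g i x = ≈-trans (sum-remove {i = i} (λ j → s j * insertAt g i x j))
    (+-cong (*-congˡ (reflexive (insertAt-lookup g i x)))
            (sum-cong-≋ λ j → *-congˡ (reflexive (insertAt-punchIn g i x j))))

  Nonzero : ∀ {n} → Vector Carrier n → Set ℓ₁
  Nonzero f = ∃ λ j → ¬ (f j ≈ 0#)

  NontrivialSolution : ∀ {n} → List (Vector Carrier n) → Set _
  NontrivialSolution rows = ∃ λ f → Nonzero f × All (λ r → r ∙ f ≈ 0#) rows

  module Pivot {n} (r : Vector Carrier (suc n)) (i : Fin (suc n)) (ri#0 : r i # 0#) where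

    private
      y : Carrier
      y = proj₁ (#0⇒inverse ri#0)

      ry≈1 : r i * y ≈ 1#
      ry≈1 = proj₂ (#0⇒inverse ri#0)

    reduce : Vector Carrier (suc n) → Vector Carrier n
    reduce s j = s (punchIn i j) + s i * - y * r (punchIn i j)

    -- The inserted entry is the unknown `i` solved from the equation of the pivot row `r`.
    extend : Vector Carrier n → Vector Carrier (suc n)
    extend g = insertAt g i (- y * (r ∘ punchIn i) ∙ g)

    -- Adjointness of `reduce` and `extend`: a solution of the reduced rows therefore extends to one
    -- of the original rows.
    ∙-extend : ∀ s g → s ∙ extend g ≈ reduce s ∙ g
    ∙-extend s g = begin
      s ∙ extend g                                    ≈⟨ ∙-insertAt s g i _ ⟩
      s i * (- y * (r ∘ punchIn i) ∙ g) + (s ∘ punchIn i) ∙ g  ≈⟨ +-comm _ _ ⟩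
      (s ∘ punchIn i) ∙ g + s i * (- y * (r ∘ punchIn i) ∙ g)  ≈⟨ +-congˡ (*-assoc _ _ _) ⟨
      (s ∘ punchIn i) ∙ g + s i * - y * (r ∘ punchIn i) ∙ g    ≈⟨ +-congˡ (*-distribˡ-sum {n} (s i * - y) (λ j → r (punchIn i j) * g j)) ⟩
      (s ∘ punchIn i) ∙ g + sum (λ j → s i * - y * (r (punchIn i j) * g j))
        ≈⟨ +-congˡ (sum-cong-≋ λ j → *-assoc (s i * - y) (r (punchIn i j)) (g j)) ⟨
      (s ∘ punchIn i) ∙ g + sum (λ j → s i * - y * r (punchIn i j) * g j)
        ≈⟨ ∑-distrib-+ {n} (λ j → s (punchIn i j) * g j) _ ⟨
      sum (λ j → s (punchIn i j) * g j + s i * - y * r (punchIn i j) * g j)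
        ≈⟨ sum-cong-≋ (λ j → distribʳ (g j) (s (punchIn i j)) (s i * - y * r (punchIn i j))) ⟨
      reduce s ∙ g ∎

    reduce-pivot : ∀ j → reduce r j ≈ 0#
    reduce-pivot j = begin
      x + r i * - y * x    ≈⟨ +-congˡ (*-congʳ (-‿distribʳ-* (r i) y)) ⟨
      x + - (r i * y) * x  ≈⟨ +-congˡ (*-congʳ (-‿cong ry≈1)) ⟩
      x + - 1# * x         ≈⟨ +-congˡ (-1*x≈-x x) ⟩
      x + - x              ≈⟨ -‿inverseʳ x ⟩
      0#                   ∎
      where x = r (punchIn i j)

    extend-nonzero : ∀ {g} → Nonzero g → Nonzero (extend g)
    extend-nonzero {g} (j , gj≉0) = punchIn i j ,
      λ ≈0 → gj≉0 (≈-trans (reflexive (sym (insertAt-punchIn g i _ j))) ≈0)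

    extend-kernel : ∀ g → r ∙ extend g ≈ 0#
    extend-kernel g = ≈-trans (∙-extend r g)
      (sum-≈0 _ λ j → ≈-trans (*-congʳ (reduce-pivot j)) (zeroˡ (g j)))

    extend-solution : ∀ {rows} → NontrivialSolution (map reduce rows) → NontrivialSolution (r ∷ rows)
    extend-solution (g , g≉0 , rows≈0) = extend g , extend-nonzero g≉0 ,
      extend-kernel g ∷ All.map (λ {s} → ≈-trans (∙-extend s g)) (All.map⁻ rows≈0)

  -- Gaussian elimination has to decide whether entries vanish, which is possible
  -- only under a double negation.
  nontrivial-solution : ∀ {n} (rows : List (Vector Carrier n)) → length rows ℕ.< n →
    ¬ ¬ NontrivialSolution rows
  nontrivial-solution {suc n} [] _ none = none ((λ _ → 1#) , (zero , 1≉0) , [])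
  nontrivial-solution {suc n} (r ∷ rows) (s≤s few) none = pivot-or-zero
    [ (λ (i , ri#0) → nontrivial-solution (map (Pivot.reduce r i ri#0) rows)
        (subst (ℕ._< n) (sym (length-map _ rows)) few)
        (none ∘ Pivot.extend-solution r i ri#0))
    , (λ r≈0 → nontrivial-solution rows (ℕ.m<n⇒m<1+n few)
        λ (f , f≉0 , rows≈0) → none (f , f≉0 ,
          sum-≈0 _ (λ j → ≈-trans (*-congʳ (r≈0 j)) (zeroˡ (f j))) ∷ rows≈0))
    ]′
    where
    -- If no entry is apart from zero, tightness makes every entry vanish.
    pivot-or-zero : ¬ ¬ ((∃ λ i → r i # 0#) ⊎ (∀ i → r i ≈ 0#))
    pivot-or-zero k = k (inj₂ λ i → proj₁ (tight (r i) 0#) λ ri#0 → k (inj₁ (i , ri#0)))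

  -- The coefficient vector serves elimination; `apply` is stored beside it so that the values of
  -- composite functionals unfold by computation.
  record Functional (n : ℕ) : Set (c ⊔ ℓ₁) where
    field
      apply   : Vector Carrier n → Carrier
      row     : Vector Carrier n
      row-rep : ∀ f → apply f ≈ row ∙ f
  open Functional public

  coordinate : ∀ {n} → Fin n → Functional n
  coordinate i = record
    { apply = λ f → f i ; row = identity F i ; row-rep = λ f → ≈-sym (identity-∙ i f) }

  _⊞_ : ∀ {n} → Functional n → Functional n → Functional n
  _⊞_ {n} K L = record
    { apply   = λ f → apply K f + apply L f
    ; row     = λ j → row K j + row L j
    ; row-rep = λ f → ≈-trans (+-cong (row-rep K f) (row-rep L f))
        (≈-trans (≈-sym (∑-distrib-+ {n} (λ j → row K j * f j) (λ j → row L j * f j))) (sum-cong-≋ λ j → ≈-sym (distribʳ (f j) (row K j) (row L j))))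
    }

  combination : ∀ {m n} → Vector Carrier m → (Fin m → Functional n) → Functional n
  combination s L = record
    { apply   = λ f → s ∙ (λ i → apply (L i) f)
    ; row     = λ j → sum (λ i → s i * row (L i) j)
    ; row-rep = λ f → ≈-trans (sum-cong-≋ λ i → *-congˡ (row-rep (L i) f)) (∙-assoc s (row ∘ L) f)
    }

  common-zero : ∀ {n} (Ls : List (Functional n)) → length Ls ℕ.< n →
    ¬ ¬ ∃ λ f → Nonzero f × All (λ L → apply L f ≈ 0#) Ls
  common-zero Ls few none = nontrivial-solution (map row Ls) (subst (ℕ._< _) (sym (length-map row Ls)) few)
    λ (f , f≉0 , rows≈0) → none (f , f≉0 , All.map (λ {L} → ≈-trans (row-rep L f)) (All.map⁻ rows≈0))

  -- Syntax, so that one form can be both evaluated at scalars and composed with functionals. Sums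
  -- of variables suffice for the four colours, since `t² = t + 1` has coefficients 1.
  data Form (m : ℕ) : Set where
    var : Fin m → Form m
    _⊕_ : Form m → Form m → Form m

  ⟦_⟧ : ∀ {m} → Form m → Vector Carrier m → Carrier
  ⟦ var a ⟧ P = P a
  ⟦ φ ⊕ ψ ⟧ P = ⟦ φ ⟧ P + ⟦ ψ ⟧ P

  ⟦⟧-cong : ∀ {m} (φ : Form m) {P Q} → (∀ a → P a ≈ Q a) → ⟦ φ ⟧ P ≈ ⟦ φ ⟧ Q
  ⟦⟧-cong (var a) P≈Q = P≈Q a
  ⟦⟧-cong (φ ⊕ ψ) P≈Q = +-cong (⟦⟧-cong φ P≈Q) (⟦⟧-cong ψ P≈Q)

  ⟦⟧-≈0 : ∀ {m} (φ : Form m) {P} → (∀ a → P a ≈ 0#) → ⟦ φ ⟧ P ≈ 0#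
  ⟦⟧-≈0 (var a) P≈0 = P≈0 a
  ⟦⟧-≈0 (φ ⊕ ψ) P≈0 = ≈-trans (+-cong (⟦⟧-≈0 φ P≈0) (⟦⟧-≈0 ψ P≈0)) (+-identityʳ 0#)

  -- Linearity of forms, which lets the matrix `A` pass through the colour of a layer.
  ⟦⟧-combination : ∀ {m n} (φ : Form m) (s : Vector Carrier n) (P : Fin n → Vector Carrier m) →
    ⟦ φ ⟧ (λ a → s ∙ (λ v → P v a)) ≈ s ∙ (λ v → ⟦ φ ⟧ (P v))
  ⟦⟧-combination (var a) s P = ≈-refl
  ⟦⟧-combination {n = n} (φ ⊕ ψ) s P = ≈-trans (+-cong (⟦⟧-combination φ s P) (⟦⟧-combination ψ s P))
    (≈-trans (≈-sym (∑-distrib-+ {n} (λ v → s v * ⟦ φ ⟧ (P v)) (λ v → s v * ⟦ ψ ⟧ (P v)))) (sum-cong-≋ λ v → ≈-sym (distribˡ (s v) _ _)))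

  substitute : ∀ {m n} → Form m → (Fin m → Functional n) → Functional n
  substitute (var a) L = L a
  substitute (φ ⊕ ψ) L = substitute φ L ⊞ substitute ψ L

  apply-substitute : ∀ {m n} (φ : Form m) (L : Fin m → Functional n) f →
    apply (substitute φ L) f ≡ ⟦ φ ⟧ (λ a → apply (L a) f)
  apply-substitute (var a) L f = refl
  apply-substitute (φ ⊕ ψ) L f = cong₂ _+_ (apply-substitute φ L f) (apply-substitute ψ L f)

  -- Let R = F[t]/(t² − t − 1), so that t and t − 1 are units.  For P = (p₁, p₂, q₁, q₂)
  -- put p = p₁ + p₂ t and q = q₁ + q₂ t in R.  The four colours stand for
  -- p, q, p + q and p + t q, written in the basis 1, t; any two of them determine
  -- p and q.  Passing to R is needed because a field with two elements has only
  -- three points on its projective line.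
  form : Fin 4 → Fin 2 → Form 4
  form 0F 0F = var 0F
  form 0F 1F = var 1F
  form 1F 0F = var 2F
  form 1F 1F = var 3F
  form 2F 0F = var 0F ⊕ var 2F
  form 2F 1F = var 1F ⊕ var 3F
  form 3F 0F = var 0F ⊕ var 3F
  form 3F 1F = var 1F ⊕ (var 2F ⊕ var 3F)

  Vanishes : Fin 4 → Vector Carrier 4 → Set ℓ₁
  Vanishes c P = ∀ j → ⟦ form c j ⟧ P ≈ 0#

  private
    +-cancel-0ˡ : ∀ {x y} → x ≈ 0# → x + y ≈ 0# → y ≈ 0#
    +-cancel-0ˡ {x} {y} x≈0 xy≈0 = ≈-trans (≈-sym (+-identityˡ y)) (≈-trans (+-congʳ (≈-sym x≈0)) xy≈0)

    +-cancel-0ʳ : ∀ {x y} → y ≈ 0# → x + y ≈ 0# → x ≈ 0#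
    +-cancel-0ʳ y≈0 xy≈0 = +-cancel-0ˡ y≈0 (≈-trans (+-comm _ _) xy≈0)

    quadruple : ∀ {P : Vector Carrier 4} → P 0F ≈ 0# → P 1F ≈ 0# → P 2F ≈ 0# → P 3F ≈ 0# → ∀ a → P a ≈ 0#
    quadruple a b c d 0F = a
    quadruple a b c d 1F = b
    quadruple a b c d 2F = c
    quadruple a b c d 3F = d

    vanish₀₁ : ∀ {P} → Vanishes 0F P → Vanishes 1F P → ∀ a → P a ≈ 0#
    vanish₀₁ v w = quadruple (v 0F) (v 1F) (w 0F) (w 1F)

    vanish₀₂ : ∀ {P} → Vanishes 0F P → Vanishes 2F P → ∀ a → P a ≈ 0#
    vanish₀₂ v w = quadruple (v 0F) (v 1F) (+-cancel-0ˡ (v 0F) (w 0F)) (+-cancel-0ˡ (v 1F) (w 1F))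

    vanish₀₃ : ∀ {P} → Vanishes 0F P → Vanishes 3F P → ∀ a → P a ≈ 0#
    vanish₀₃ v w = quadruple (v 0F) (v 1F) (+-cancel-0ʳ q₂≈0 (+-cancel-0ˡ (v 1F) (w 1F))) q₂≈0
      where q₂≈0 = +-cancel-0ˡ (v 0F) (w 0F)

    vanish₁₂ : ∀ {P} → Vanishes 1F P → Vanishes 2F P → ∀ a → P a ≈ 0#
    vanish₁₂ v w = quadruple (+-cancel-0ʳ (v 0F) (w 0F)) (+-cancel-0ʳ (v 1F) (w 1F)) (v 0F) (v 1F)

    vanish₁₃ : ∀ {P} → Vanishes 1F P → Vanishes 3F P → ∀ a → P a ≈ 0#
    vanish₁₃ v w = quadruple (+-cancel-0ʳ (v 1F) (w 0F))
      (+-cancel-0ʳ (≈-trans (+-cong (v 0F) (v 1F)) (+-identityʳ 0#)) (w 1F)) (v 0F) (v 1F)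

    -- The two colours differ by `(t − 1) q`, whose `t`-component is `q₁`; so `q₁` is the first
    -- coordinate to be found zero.
    vanish₂₃ : ∀ {P} → Vanishes 2F P → Vanishes 3F P → ∀ a → P a ≈ 0#
    vanish₂₃ {P} v w = quadruple p₁≈0 (+-cancel-0ʳ q₂≈0 (v 1F)) q₁≈0 q₂≈0
      where
      q₁≈0 : P 2F ≈ 0#
      q₁≈0 = +-cancel-0ˡ (v 1F) (≈-trans (+-assoc _ _ _) (≈-trans (+-congˡ (+-comm _ _)) (w 1F)))
      p₁≈0 = +-cancel-0ʳ q₁≈0 (v 0F)
      q₂≈0 = +-cancel-0ˡ p₁≈0 (w 0F)

  two-colours-determine : ∀ c d → c ≢ d → ∀ {P} → Vanishes c P → Vanishes d P → ∀ a → P a ≈ 0#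
  two-colours-determine 0F 0F c≢d = contradiction refl c≢d
  two-colours-determine 0F 1F _ v w = vanish₀₁ v w
  two-colours-determine 0F 2F _ v w = vanish₀₂ v w
  two-colours-determine 0F 3F _ v w = vanish₀₃ v w
  two-colours-determine 1F 0F _ v w = vanish₀₁ w v
  two-colours-determine 1F 1F c≢d = contradiction refl c≢d
  two-colours-determine 1F 2F _ v w = vanish₁₂ v w
  two-colours-determine 1F 3F _ v w = vanish₁₃ v w
  two-colours-determine 2F 0F _ v w = vanish₀₂ w v
  two-colours-determine 2F 1F _ v w = vanish₁₂ w v
  two-colours-determine 2F 2F c≢d = contradiction refl c≢d
  two-colours-determine 2F 3F _ v w = vanish₂₃ v w
  two-colours-determine 3F 0F _ v w = vanish₀₃ w v
  two-colours-determine 3F 1F _ v w = vanish₁₃ w v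
  two-colours-determine 3F 2F _ v w = vanish₂₃ w v
  two-colours-determine 3F 3F c≢d = contradiction refl c≢d

  -- Takes the place of the relation with unit coefficients among three consecutive layers: any one
  -- of them may be the unknown.
  third-colour : ∀ c d e → c ≢ d → ∀ {P} → Vanishes c P → Vanishes d P → Vanishes e P
  third-colour c d e c≢d v w j = ⟦⟧-≈0 (form e j) (two-colours-determine c d c≢d v w)

  module _ {n} {A : Matrix F n} (A-involutory : Involutory F A) where

    -- As `A² = 1`, the exponent matters only modulo 2.
    power : Bool → Vector Carrier n → Vector Carrier n
    power false p u = p u
    power true  p u = A u ∙ p

    A∙power : ∀ b p u → A u ∙ power b p ≈ power (not b) p u
    A∙power false p u = ≈-refl
    A∙power true  p u = begin
      A u ∙ (λ v → A v ∙ p)  ≈⟨ ∙-assoc (A u) A p ⟩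
      (_⊗_ F A A) u ∙ p      ≈⟨ sum-cong-≋ (λ w → *-congʳ (A-involutory u w)) ⟩
      identity F u ∙ p       ≈⟨ identity-∙ u p ⟩
      p u                    ∎

open import Data.Nat.Base using (_+_; _*_; _≤_)

-- Cycles and their colourings

parity : ℕ → Bool
parity zero    = false
parity (suc m) = not (parity m)

parity-double : ∀ k → parity (2 * k) ≡ false
parity-double zero = refl
parity-double (suc k) = trans (cong parity (ℕ.*-suc 2 k)) (trans (not-involutive _) (parity-double k))

next : ∀ {m} (i : Fin m) → ∃ (Next i)
next {suc m} i with ℕ.m≤n⇒m<n∨m≡n (toℕ<n i)
... | inj₁ lt = fromℕ< lt , inj₁ (toℕ-fromℕ< lt)
... | inj₂ eq = zero , inj₂ (eq , refl)

prev : ∀ {m} (i : Fin m) → ∃ λ j → Next j i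
prev {suc m} zero = fromℕ m , inj₂ (cong suc (toℕ-fromℕ m) , refl)
prev (suc i) = inject₁ i , inj₁ (cong suc (sym (toℕ-inject₁ i)))

next-unique : ∀ {m} {i j j′ : Fin m} → Next i j → Next i j′ → j ≡ j′
next-unique (inj₁ p) (inj₁ q) = toℕ-injective (trans p (sym q))
next-unique (inj₂ (_ , p)) (inj₂ (_ , q)) = toℕ-injective (trans p (sym q))
next-unique {j = j} (inj₁ p) (inj₂ (q , _)) = contradiction (toℕ<n j) (ℕ.<-irrefl (trans p q))
next-unique {j′ = j} (inj₂ (q , _)) (inj₁ p) = contradiction (toℕ<n j) (ℕ.<-irrefl (trans p q))

prev-unique : ∀ {m} {i j j′ : Fin m} → Next j i → Next j′ i → j ≡ j′
prev-unique (inj₁ p) (inj₁ q) = toℕ-injective (ℕ.suc-injective (trans (sym p) q))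
prev-unique (inj₂ (p , _)) (inj₂ (q , _)) = toℕ-injective (ℕ.suc-injective (trans p (sym q)))
prev-unique (inj₁ p) (inj₂ (_ , q)) with () ← trans (sym p) q
prev-unique (inj₂ (_ , q)) (inj₁ p) with () ← trans (sym p) q

next-parity : ∀ {m} → parity m ≡ false → ∀ {i j : Fin m} → Next i j →
  parity (toℕ j) ≡ not (parity (toℕ i))
next-parity even (inj₁ p) = cong parity p
next-parity even (inj₂ (p , q)) = trans (cong parity q) (trans (sym even) (sym (cong parity p)))

Colour : Set
Colour = Fin 4

-- Colours form an infinite sequence, so that conditions at distance 1 and 2 involve no wrapping;
-- the first two colours repeated from position `m` close it up to a cycle.
record Colouring (m : ℕ) : Set where
  field
    colour    : ℕ → Colour
    adjacent  : ∀ i → colour i ≢ colour (suc i)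
    distance₂ : ∀ i → colour i ≢ colour (2 + i)
    wraps₀    : colour m ≡ colour 0
    wraps₁    : colour (suc m) ≡ colour 1

  next-colour : ∀ {i j : Fin m} → Next i j → colour (toℕ j) ≡ colour (suc (toℕ i))
  next-colour (inj₁ p) = cong colour p
  next-colour (inj₂ (p , q)) = trans (cong colour q) (trans (sym wraps₀) (sym (cong colour p)))

  next²-colour : ∀ {i j l : Fin m} → Next i j → Next j l → colour (toℕ l) ≡ colour (2 + toℕ i)
  next²-colour (inj₁ p) jl = trans (next-colour jl) (cong colour (cong suc p))
  next²-colour (inj₂ (p , q)) jl = trans (next-colour jl)
    (trans (cong colour (cong suc q)) (trans (sym wraps₁) (sym (cong colour (cong suc p)))))

  next-≢ : ∀ {i j : Fin m} → Next i j → colour (toℕ i) ≢ colour (toℕ j)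
  next-≢ {i} ij eq = adjacent (toℕ i) (trans eq (next-colour ij))

  next²-≢ : ∀ {i j l : Fin m} → Next i j → Next j l → colour (toℕ i) ≢ colour (toℕ l)
  next²-≢ {i} ij jl eq = distance₂ (toℕ i) (trans eq (next²-colour ij jl))

-- The colourings are words (0123)ᵃ(012)ᵇ with a ≤ 2 and 4 a + 3 b = 2 k.
cyclic₃ : ℕ → Colour
cyclic₃ 0 = 0F
cyclic₃ 1 = 1F
cyclic₃ 2 = 2F
cyclic₃ (suc (suc (suc i))) = cyclic₃ i

prepend₄ : (ℕ → Colour) → ℕ → Colour
prepend₄ f 0 = 0F
prepend₄ f 1 = 1F
prepend₄ f 2 = 2F
prepend₄ f 3 = 3F
prepend₄ f (suc (suc (suc (suc i)))) = f i

-- Starting with 0, 1 is what keeps the seam proper when a block 0123 is put in front, and what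
-- allows the word to be closed up.
record Proper (f : ℕ → Colour) : Set where
  field
    starts₀   : f 0 ≡ 0F
    starts₁   : f 1 ≡ 1F
    adjacent  : ∀ i → f i ≢ f (suc i)
    distance₂ : ∀ i → f i ≢ f (2 + i)

cyclic₃-proper : Proper cyclic₃
cyclic₃-proper = record { starts₀ = refl ; starts₁ = refl ; adjacent = adj ; distance₂ = dist }
  where
  adj : ∀ i → cyclic₃ i ≢ cyclic₃ (suc i)
  adj 0 ()
  adj 1 ()
  adj 2 ()
  adj (suc (suc (suc i))) = adj i
  dist : ∀ i → cyclic₃ i ≢ cyclic₃ (2 + i)
  dist 0 ()
  dist 1 ()
  dist 2 ()
  dist (suc (suc (suc i))) = dist i

prepend₄-proper : ∀ {f} → Proper f → Proper (prepend₄ f)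
prepend₄-proper {f} pf = record { starts₀ = refl ; starts₁ = refl ; adjacent = adj ; distance₂ = dist }
  where
  open Proper pf
  adj : ∀ i → prepend₄ f i ≢ prepend₄ f (suc i)
  adj 0 ()
  adj 1 ()
  adj 2 ()
  adj 3 eq with () ← trans eq starts₀
  adj (suc (suc (suc (suc i)))) = adjacent i
  dist : ∀ i → prepend₄ f i ≢ prepend₄ f (2 + i)
  dist 0 ()
  dist 1 ()
  dist 2 eq with () ← trans eq starts₀
  dist 3 eq with () ← trans eq starts₁
  dist (suc (suc (suc (suc i)))) = distance₂ i

cyclic₃-period : ∀ b → cyclic₃ (b * 6) ≡ 0F × cyclic₃ (suc (b * 6)) ≡ 1F
cyclic₃-period zero    = refl , refl
cyclic₃-period (suc b) = cyclic₃-period b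

close : ∀ {f m} → Proper f → f m ≡ 0F × f (suc m) ≡ 1F → Colouring m
close {f} pf (f₀ , f₁) = record
  { colour = f ; adjacent = adjacent ; distance₂ = distance₂
  ; wraps₀ = trans f₀ (sym starts₀) ; wraps₁ = trans f₁ (sym starts₁) }
  where open Proper pf

residue₃ : ∀ k → ∃ λ b → k ≡ b * 3 ⊎ k ≡ 1 + b * 3 ⊎ k ≡ 2 + b * 3
residue₃ 0 = 0 , inj₁ refl
residue₃ 1 = 0 , inj₂ (inj₁ refl)
residue₃ 2 = 0 , inj₂ (inj₂ refl)
residue₃ (suc (suc (suc k))) with residue₃ k
... | b , inj₁ refl        = suc b , inj₁ refl
... | b , inj₂ (inj₁ refl) = suc b , inj₂ (inj₁ refl)
... | b , inj₂ (inj₂ refl) = suc b , inj₂ (inj₂ refl)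

colouring : ∀ {k} → 2 ≤ k → Colouring (2 * k)
-- Here `k` is two less than half the length. Its residues 0, 1, 2 modulo 3 give lengths `4 + 6 b`,
-- `6 + 6 b`, `8 + 6 b`, coloured with one, no and two blocks 0123.
colouring {suc (suc k)} (s≤s (s≤s z≤n)) with residue₃ k
... | b , inj₁ refl = subst Colouring (length₄ b)
  (close (prepend₄-proper cyclic₃-proper) (cyclic₃-period b))
  where
  length₄ : ∀ b → 4 + b * 6 ≡ 2 * (2 + b * 3)
  length₄ = solve-∀
... | b , inj₂ (inj₁ refl) = subst Colouring (length₆ b)
  (close cyclic₃-proper (cyclic₃-period b))
  where
  length₆ : ∀ b → 6 + b * 6 ≡ 2 * (3 + b * 3)
  length₆ = solve-∀
... | b , inj₂ (inj₂ refl) = subst Colouring (length₈ b)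
  (close (prepend₄-proper (prepend₄-proper cyclic₃-proper)) (cyclic₃-period b))
  where
  length₈ : ∀ b → 8 + b * 6 ≡ 2 * (4 + b * 3)
  length₈ = solve-∀

-- The product of a bipartite graph with an even cycle

elements : ∀ {m} → Subset m → List (Fin m)
elements []            = []
elements (inside  ∷ S) = zero ∷ map suc (elements S)
elements (outside ∷ S) = map suc (elements S)

length-elements : ∀ {m} (S : Subset m) → length (elements S) ≡ ∣ S ∣
length-elements []            = refl
length-elements (inside  ∷ S) = cong suc (trans (length-map suc (elements S)) (length-elements S))
length-elements (outside ∷ S) = trans (length-map suc (elements S)) (length-elements S)

∈-elements : ∀ {m} {S : Subset m} {x} → x ∈ S → x ∈ˡ elements S
∈-elements {S = inside  ∷ S} here      = here refl
∈-elements {S = inside  ∷ S} (there p) = there (∈-map⁺ suc (∈-elements p))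
∈-elements {S = outside ∷ S} (there p) = ∈-map⁺ suc (∈-elements p)

fromList : ∀ {m} → List (Fin m) → Subset m
fromList = ⋃ ∘ map ⁅_⁆

∈-fromList⁺ : ∀ {m} {x : Fin m} {xs} → x ∈ˡ xs → x ∈ fromList xs
∈-fromList⁺ (here refl) = x∈p∪q⁺ (inj₁ (x∈⁅x⁆ _))
∈-fromList⁺ (there p)   = x∈p∪q⁺ (inj₂ (∈-fromList⁺ p))

∈-fromList⁻ : ∀ {m} {x : Fin m} xs → x ∈ fromList xs → x ∈ˡ xs
∈-fromList⁻ []       p = contradiction p ∉⊥
∈-fromList⁻ (y ∷ ys) p with x∈p∪q⁻ ⁅ y ⁆ (fromList ys) p
... | inj₁ q = here (x∈⁅y⁆⇒x≡y y q)
... | inj₂ q = there (∈-fromList⁻ ys q)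

∣⁅x⁆∪p∣≤1+∣p∣ : ∀ {m} (x : Fin m) p → ∣ ⁅ x ⁆ ∪ p ∣ ≤ suc ∣ p ∣
∣⁅x⁆∪p∣≤1+∣p∣ zero    (inside  ∷ p) rewrite ∪-identityˡ p = ℕ.n≤1+n _
∣⁅x⁆∪p∣≤1+∣p∣ zero    (outside ∷ p) rewrite ∪-identityˡ p = ℕ.≤-refl
∣⁅x⁆∪p∣≤1+∣p∣ (suc x) (inside  ∷ p) = s≤s (∣⁅x⁆∪p∣≤1+∣p∣ x p)
∣⁅x⁆∪p∣≤1+∣p∣ (suc x) (outside ∷ p) = ∣⁅x⁆∪p∣≤1+∣p∣ x p

∣fromList∣≤length : ∀ {m} (xs : List (Fin m)) → ∣ fromList xs ∣ ≤ length xs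
∣fromList∣≤length {m} [] = ℕ.≤-reflexive (∣⊥∣≡0 m)
∣fromList∣≤length (x ∷ xs) = ℕ.≤-trans (∣⁅x⁆∪p∣≤1+∣p∣ x (fromList xs)) (s≤s (∣fromList∣≤length xs))

-- Vanishing in the field is undecided, but finitely many instances may be decided at once while a
-- contradiction is being derived.
¬¬-decide : ∀ {n ℓ} (P : Pred (Fin n) ℓ) → ¬ ¬ Decidable P
¬¬-decide P = sequence (RawMonad.rawApplicative ¬¬-Monad) (λ i → ¬¬-excluded-middle)

module Prism {n} (G : Graph n) (G-bip : Bipartite G)
             {m} (3≤m : 3 ≤ m) (even : parity m ≡ false) where

  H : Graph (n * m)
  H = G □ cycle m 3≤m

  open Matchings H

  Vertex : Set
  Vertex = Fin n × Fin m

  encode : Vertex → Fin (n * m)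
  encode (v , i) = combine v i

  decode : Fin (n * m) → Vertex
  decode = remQuot m

  _~_ : Vertex → Vertex → Set
  _~_ = □-Adj G (cycle m 3≤m)

  decode-encode : ∀ x → decode (encode x) ≡ x
  decode-encode (v , i) = remQuot-combine v i

  encode-decode : ∀ x → encode (decode x) ≡ x
  encode-decode = combine-remQuot {n} m

  side : Fin n → Bool
  side = proj₁ G-bip

  side-flips : ∀ {u v} → Adj G u v → side v ≡ not (side u)
  side-flips a = ¬-not (proj₂ G-bip _ _ a ∘ sym)

  -- The bipartition of the product; it is consistent across the seam of the cycle because `m` is
  -- even.
  class : Vertex → Bool
  class (v , i) = side v xor parity (toℕ i)

  class-next : ∀ v {i j} → Next i j → class (v , j) ≡ not (class (v , i))
  class-next v {i} ij = trans (cong (side v xor_) (next-parity even ij))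
    (sym (not-distribʳ-xor (side v) (parity (toℕ i))))

  class-adj : ∀ {u v} i → Adj G u v → class (v , i) ≡ not (class (u , i))
  class-adj {u} i a = trans (cong (_xor parity (toℕ i)) (side-flips a))
    (sym (not-distribˡ-xor (side u) (parity (toℕ i))))

  class-flips : ∀ {x y} → x ~ y → class y ≡ not (class x)
  class-flips {u , i} {_ , j} (inj₁ (refl , inj₁ ij)) = class-next u ij
  class-flips {u , i} {_ , j} (inj₁ (refl , inj₂ ji)) =
    trans (sym (not-involutive _)) (cong not (sym (class-next u ji)))
  class-flips {_ , i} (inj₂ (refl , a)) = class-adj i a

  H-bip : Bipartite H
  H-bip = class ∘ decode , λ x y a → not-¬ {x = class (decode x)} refl ∘ λ eq → trans eq (class-flips a)

  layer₀ : Fin m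
  layer₀ = fromℕ< (ℕ.≤-trans (s≤s z≤n) 3≤m)

  toℕ-layer₀ : toℕ layer₀ ≡ 0
  toℕ-layer₀ = toℕ-fromℕ< _

  -- Lower bound: the kernel vectors

  module _ {c ℓ₁ ℓ₂} (F : HeytingField c ℓ₁ ℓ₂) {A : Matrix F n} (A∈𝓘 : 𝓘 F G A)
           (colours : Colouring m) where

    open Colouring colours
    open LinearAlgebra F
    open HeytingField F using (0#; Carrier; _≈_) renaming (_*_ to _·_)
    open HeytingCommutativeRing (HeytingField.heytingCommutativeRing F) using (commutativeRing)
    open CommutativeRing commutativeRing using (*-congˡ; *-congʳ; zeroˡ; zeroʳ)
      renaming (sym to ≈-sym; trans to ≈-trans; reflexive to ≈-reflexive)

    hue : Fin m → Colour
    hue = colour ∘ toℕ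

    nonadjacent-≈0 : ∀ {u v} → ¬ Adj G u v → A u v ≈ 0#
    nonadjacent-≈0 ¬uv = ≈0-stable (¬uv ∘ Equivalence.to (proj₁ A∈𝓘 _ _))

    powerᶠ : ∀ {N} → Bool → (Fin n → Functional N) → Fin n → Functional N
    powerᶠ false L u = L u
    powerᶠ true  L u = combination (A u) L

    apply-powerᶠ : ∀ {N} b (L : Fin n → Functional N) u f →
      apply (powerᶠ b L u) f ≡ power (proj₂ A∈𝓘) b (λ v → apply (L v) f) u
    apply-powerᶠ false L u f = refl
    apply-powerᶠ true  L u f = refl

    -- Component `j` over `F` of the kernel vector, which has entries in `R`. The unknowns are `p₁`,
    -- `p₂`, `q₁`, `q₂` at each vertex of `G`, so rank `2 n` over `R` appears as `4 n` over `F`.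
    value : Vertex → Fin 2 → Functional (4 * n)
    value (u , i) j = substitute (form (hue i) j)
      (λ a → powerᶠ (parity (toℕ i)) (λ v → coordinate (combine a v)) u)

    -- Two ends with two components each make four conditions per edge, to be compared with four
    -- unknowns per vertex of `G`.
    constraints : List (Edge H) → List (Functional (4 * n))
    constraints []       = []
    constraints (e ∷ es) =
      let u = decode (proj₁ (lookup (edges H) e)) ; v = decode (proj₂ (lookup (edges H) e)) in
      value u 0F ∷ value u 1F ∷ value v 0F ∷ value v 1F ∷ constraints es

    length-constraints : ∀ es → length (constraints es) ≡ length es * 4
    length-constraints []       = refl
    length-constraints (e ∷ es) = cong (4 +_) (length-constraints es)

    module Solution (f : Fin (4 * n) → Carrier) where

      point : Bool → Fin n → Fin 4 → Carrier
      point b u a = power (proj₂ A∈𝓘) b (λ v → f (combine a v)) u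

      Zero : Vertex → Set ℓ₁
      Zero (u , i) = Vanishes (hue i) (point (parity (toℕ i)) u)

      value-≈ : ∀ x j → apply (value x j) f ≈ ⟦ form (hue (proj₂ x)) j ⟧ (point (parity (toℕ (proj₂ x))) (proj₁ x))
      value-≈ (u , i) j = ≈-trans (≈-reflexive (apply-substitute (form (hue i) j) _ f))
        (⟦⟧-cong (form (hue i) j) λ a → ≈-reflexive (apply-powerᶠ (parity (toℕ i)) _ u f))

      zero-value : ∀ x → apply (value x 0F) f ≈ 0# → apply (value x 1F) f ≈ 0# → Zero x
      zero-value x p q 0F = ≈-trans (≈-sym (value-≈ x 0F)) p
      zero-value x p q 1F = ≈-trans (≈-sym (value-≈ x 1F)) q

      constraints-ends : ∀ {e es} → e ∈ˡ es → All (λ L → apply L f ≈ 0#) (constraints es) →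
        Zero (decode (proj₁ (lookup (edges H) e))) × Zero (decode (proj₂ (lookup (edges H) e)))
      constraints-ends (here refl) (p ∷ q ∷ r ∷ s ∷ _)  = zero-value _ p q , zero-value _ r s
      constraints-ends (there e∈) (_ ∷ _ ∷ _ ∷ _ ∷ ps) = constraints-ends e∈ ps

      -- The kernel equation at `(u , j)`. Layers `i` and `l` have the parity opposite to `j`, and
      -- applying `A` to layer `j` flips its exponent too, so all three contributions are colours of
      -- the same point `P`.
      module Equation {i j l : Fin m} (ij : Next i j) (jl : Next j l) (u : Fin n) where

        P : Fin 4 → Carrier
        P = point (not (parity (toℕ j))) u

        parity-i : parity (toℕ i) ≡ not (parity (toℕ j))
        parity-i = trans (sym (not-involutive _)) (cong not (sym (next-parity even ij)))

        before : Zero (u , i) → Vanishes (hue i) P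
        before = subst (λ b → Vanishes (hue i) (point b u)) parity-i

        before⁻ : Vanishes (hue i) P → Zero (u , i)
        before⁻ = subst (λ b → Vanishes (hue i) (point b u)) (sym parity-i)

        after : Zero (u , l) → Vanishes (hue l) P
        after = subst (λ b → Vanishes (hue l) (point b u)) (next-parity even jl)

        after⁻ : Vanishes (hue l) P → Zero (u , l)
        after⁻ = subst (λ b → Vanishes (hue l) (point b u)) (sym (next-parity even jl))

        layer-sum : ∀ t → A u ∙ (λ v → ⟦ form (hue j) t ⟧ (point (parity (toℕ j)) v))
                        ≈ ⟦ form (hue j) t ⟧ P
        layer-sum t = ≈-trans
          (≈-sym (⟦⟧-combination φ (A u) (point (parity (toℕ j)))))
          (⟦⟧-cong φ λ a → A∙power (proj₂ A∈𝓘) (parity (toℕ j)) _ u)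
          where φ = form (hue j) t

        off-≈0 : ∀ v t → (Adj G u v → Zero (v , j)) →
          A u v · ⟦ form (hue j) t ⟧ (point (parity (toℕ j)) v) ≈ 0#
        off-≈0 v t zeroes with adj? G u v
        ... | yes uv = ≈-trans (*-congˡ (zeroes uv t)) (zeroʳ _)
        ... | no ¬uv = ≈-trans (*-congʳ (nonadjacent-≈0 ¬uv)) (zeroˡ _)

        layer : (∀ v → Adj G u v → Zero (v , j)) → Vanishes (hue j) P
        layer zeroes t = ≈-trans (≈-sym (layer-sum t)) (sum-≈0 _ λ v → off-≈0 v t (zeroes v))

        -- The sum over layer `j` reduces to the single term of `v`, from which the nonzero entry
        -- `A u v` is cancelled.
        layer⁻ : ∀ {v} → Adj G u v → (∀ v′ → Adj G u v′ → v′ ≢ v → Zero (v′ , j)) →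
          Vanishes (hue j) P → Zero (v , j)
        layer⁻ {v} uv zeroes vanishes t = ≉0-cancelˡ (Equivalence.from (proj₁ A∈𝓘 u v) uv)
          (≈-trans (≈-sym (sum-single _ v λ v′ v′≢v → off-≈0 v′ t λ uv′ → zeroes v′ uv′ v′≢v))
            (≈-trans (layer-sum t) (vanishes t)))

      -- The unknown neighbour lies in the next, the previous or the same layer; `third-colour`
      -- applies to the other two layers. Neighbours in different layers are told apart by their
      -- hues.
      propagates : ∀ w a → w ~ a → (∀ b → w ~ b → b ≢ a → Zero b) → Zero a
      propagates (u , j) (_ , l) (inj₁ (refl , inj₁ jl)) others =
        after⁻ (third-colour (hue i) (hue j) (hue l) (next-≢ ij)
          (before (others (u , i) (inj₁ (refl , inj₂ ij)) (next²-≢ ij jl ∘ cong (hue ∘ proj₂))))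
          (layer λ v uv → others (v , j) (inj₂ (refl , uv)) (next-≢ jl ∘ cong (hue ∘ proj₂))))
        where
        i = proj₁ (prev j)
        ij = proj₂ (prev j)
        open Equation ij jl u
      propagates (u , j) (_ , i) (inj₁ (refl , inj₂ ij)) others =
        before⁻ (third-colour (hue j) (hue l) (hue i) (next-≢ jl)
          (layer λ v uv → others (v , j) (inj₂ (refl , uv)) (next-≢ ij ∘ sym ∘ cong (hue ∘ proj₂)))
          (after (others (u , l) (inj₁ (refl , inj₁ jl)) (next²-≢ ij jl ∘ sym ∘ cong (hue ∘ proj₂)))))
        where
        l = proj₁ (next j)
        jl = proj₂ (next j)
        open Equation ij jl u
      propagates (u , j) (v , _) (inj₂ (refl , uv)) others =
        layer⁻ uv (λ v′ uv′ v′≢v → others (v′ , j) (inj₂ (refl , uv′)) (v′≢v ∘ cong proj₁))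
          (third-colour (hue i) (hue l) (hue j) (next²-≢ ij jl)
            (before (others (u , i) (inj₁ (refl , inj₂ ij)) (next-≢ ij ∘ cong (hue ∘ proj₂))))
            (after (others (u , l) (inj₁ (refl , inj₁ jl)) (next-≢ jl ∘ sym ∘ cong (hue ∘ proj₂)))))
        where
        i = proj₁ (prev j)
        l = proj₁ (next j)
        ij = proj₂ (prev j)
        jl = proj₂ (next j)
        open Equation ij jl u

      propagates-coded : ∀ w a → Adj H w a → (∀ b → Adj H w b → b ≢ a → Zero (decode b)) → Zero (decode a)
      propagates-coded w a wa others = propagates (decode w) (decode a) wa λ b wb b≢a →
        subst Zero (decode-encode b) (others (encode b)
          (subst (decode w ~_) (sym (decode-encode b)) wb)
          λ eq → b≢a (trans (sym (decode-encode b)) (cong decode eq)))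

      -- Layers 0 and 2 both carry exponent 0, hence show two distinct colours of the unknowns
      -- themselves, and these determine the unknowns.
      zero-everywhere : (∀ x → Zero x) → ∀ k → f k ≈ 0#
      zero-everywhere zeroes k =
        let _ , l₀₁ = next layer₀
            l₂ , l₁₂ = next _
            a , v = remQuot {4} n k
            b₀ = cong parity toℕ-layer₀
            b₂ = trans (next-parity even l₁₂) (trans (cong not (next-parity even l₀₁)) (trans (not-involutive _) b₀))
        in ≈-trans (≈-reflexive (cong f (sym (combine-remQuot {4} n k))))
          (two-colours-determine (hue layer₀) (hue l₂) (next²-≢ l₀₁ l₁₂)
            (subst (λ b → Vanishes (hue layer₀) (point b v)) b₀ (zeroes (v , layer₀)))
            (subst (λ b → Vanishes (hue l₂) (point b v)) b₂ (zeroes (v , l₂))) a)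

      constrained⇒zero : ∀ {M S} → PerfectMatching H M → ForcingSet H M S →
        All (λ L → apply L f ≈ 0#) (constraints (elements S)) → Decidable (Zero ∘ decode) →
        ∀ k → f k ≈ 0#
      constrained⇒zero pm forcing constrained zero? = zero-everywhere λ x →
        subst Zero (decode-encode x) (forcing-set-spreads H-bip pm forcing zero? propagates-coded
          (λ { e∈S (inj₁ refl) → proj₁ (constraints-ends (∈-elements e∈S) constrained)
             ; e∈S (inj₂ refl) → proj₂ (constraints-ends (∈-elements e∈S) constrained) })
          (encode x))

    -- With fewer than `n` edges there are fewer than `4 n` conditions, so a nonzero solution exists
    -- up to double negation, yet it must vanish everywhere.
    forcing-set-large : ∀ {M S} → PerfectMatching H M → ForcingSet H M S → n ≤ ∣ S ∣
    forcing-set-large {M} {S} pm forcing = ℕ.≮⇒≥ λ ∣S∣<n →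
      common-zero (constraints (elements S)) (few ∣S∣<n) λ (f , (k , fk≉0) , constrained) →
        ¬¬-decide (Solution.Zero f ∘ decode) λ zero? →
          fk≉0 (Solution.constrained⇒zero f pm forcing constrained zero? k)
      where
      few : ∣ S ∣ ℕ.< n → length (constraints (elements S)) ℕ.< 4 * n
      few ∣S∣<n rewrite length-constraints (elements S) | length-elements S | ℕ.*-comm 4 n =
        ℕ.*-monoˡ-< 4 ∣S∣<n

  -- Upper bound: a matching forced by its edges at layer 0

  step : Bool → Fin m → Fin m
  step false i = proj₁ (next i)
  step true  i = proj₁ (prev i)

  step-not : ∀ b i → step (not b) (step b i) ≡ i
  step-not false i = prev-unique (proj₂ (prev (proj₁ (next i)))) (proj₂ (next i))
  step-not true  i = next-unique (proj₂ (next (proj₁ (prev i)))) (proj₂ (prev i))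

  -- Traversed from class false to class true, every matching edge advances one
  -- layer, and every other edge, traversed from class true to class false,
  -- advances by at most one layer.  So each alternating cycle winds around and
  -- uses an edge at layer 0.
  mate : Vertex → Vertex
  mate x@(v , i) = v , step (class x) i

  mate-adj : ∀ x → x ~ mate x
  mate-adj x@(v , i) with class x
  ... | false = inj₁ (refl , inj₁ (proj₂ (next i)))
  ... | true  = inj₁ (refl , inj₂ (proj₂ (prev i)))

  mate-involutive : ∀ x → mate (mate x) ≡ x
  mate-involutive x@(v , i) = cong (v ,_) (trans
    (cong (λ b → step b (step (class x) i)) (class-flips (mate-adj x)))
    (step-not (class x) i))

  ν : Fin (n * m) → Fin (n * m)
  ν = encode ∘ mate ∘ decode

  ν-encode : ∀ x → ν (encode x) ≡ encode (mate x)
  ν-encode x = cong (encode ∘ mate) (decode-encode x)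

  ν-adj : ∀ x → Adj H x (ν x)
  ν-adj x = subst (decode x ~_) (sym (decode-encode _)) (mate-adj (decode x))

  ν-involutive : ∀ x → ν (ν x) ≡ x
  ν-involutive x = trans (ν-encode (mate (decode x)))
    (trans (cong encode (mate-involutive (decode x))) (encode-decode x))

  open OfInvolution ν ν-adj ν-involutive

  layer₀-edge : Fin n → Edge H
  layer₀-edge v = proj₁ (edge-of (encode (v , layer₀)))

  S₀ : EdgeSet H
  S₀ = fromList (List.tabulate layer₀-edge)

  -- The reverse inequality comes from the lower bound for all forcing sets, applied to `S₀`.
  ∣S₀∣≤n : ∣ S₀ ∣ ≤ n
  ∣S₀∣≤n = ℕ.≤-trans (∣fromList∣≤length (List.tabulate layer₀-edge))
    (ℕ.≤-reflexive (length-tabulate layer₀-edge))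

  module Forced (M′ : EdgeSet H) (pm′ : PerfectMatching H M′) (S₀⊆M′ : S₀ ⊆ M′) where

    open Partner M′ pm′

    Agrees : Vertex → Set
    Agrees x = partner (encode x) ≡ encode (mate x)

    agrees-mate : ∀ x → Agrees x → Agrees (mate x)
    agrees-mate x ax = begin
      partner (encode (mate x))       ≡⟨ cong partner ax ⟨
      partner (partner (encode x))    ≡⟨ partner-involutive (encode x) ⟩
      encode x                        ≡⟨ cong encode (mate-involutive x) ⟨
      encode (mate (mate x))          ∎
      where open ≡-Reasoning

    agrees-layer₀ : ∀ v → Agrees (v , layer₀)
    agrees-layer₀ v = trans
      (partner-unique (S₀⊆M′ (∈-fromList⁺ (∈-tabulate⁺ v))) (proj₂ (edge-of (encode (v , layer₀)))))
      (ν-encode (v , layer₀))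

    -- Induction step from layer `h` to layer `i`: vertices of class true are mates of vertices in
    -- layer `h`, and this leaves those of class false no other choice than their mates.
    module Layer {h i : Fin m} (hi : Next h i) (h≢i : h ≢ i) (below : ∀ v → Agrees (v , h)) where

      agrees-backward : ∀ v → class (v , i) ≡ true → Agrees (v , i)
      agrees-backward v backward = subst Agrees mate-h (agrees-mate (v , h) (below v))
        where
        forward-h : class (v , h) ≡ false
        forward-h = trans (sym (not-involutive _)) (cong not (trans (sym (class-next v hi)) backward))

        mate-h : mate (v , h) ≡ (v , i)
        mate-h = cong (v ,_) (trans (cong (λ b → step b h) forward-h) (next-unique (proj₂ (next h)) hi))

      partner-cases : ∀ v → class (v , i) ≡ false → ∀ z → (v , i) ~ z →
        partner (encode (v , i)) ≡ encode z → Agrees (v , i)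
      partner-cases v forward (_ , l) (inj₁ (refl , inj₁ il)) eq = trans eq
        (cong (encode ∘ (v ,_)) (trans (next-unique il (proj₂ (next i))) (cong (λ b → step b i) (sym forward))))
      -- If the partner is `(v , h)`, agreement at layer `h` identifies `(v , i)` with the mate of
      -- `(v , h)`, and agreement passes to mates.
      partner-cases v forward (_ , l) (inj₁ (refl , inj₂ li)) eq with refl ← prev-unique li hi =
        subst Agrees mate-h (agrees-mate (v , h) (below v))
        where
        encode-mate : encode (mate (v , h)) ≡ encode (v , i)
        encode-mate = trans (sym (below v)) (trans (cong partner (sym eq)) (partner-involutive _))

        mate-h : mate (v , h) ≡ (v , i)
        mate-h = trans (sym (decode-encode _)) (trans (cong decode encode-mate) (decode-encode _))
      -- A neighbour in the same layer has class true, so it is already matched into layer `h`.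
      partner-cases v forward (v′ , _) (inj₂ (refl , vv′)) eq =
        contradiction (sym (combine-injectiveʳ v i v′ h i≡h)) h≢i
        where
        backward : class (v′ , i) ≡ true
        backward = trans (class-adj i vv′) (cong not forward)

        i≡h : encode (v , i) ≡ encode (v′ , h)
        i≡h = begin
          encode (v , i)                   ≡⟨ partner-involutive _ ⟨
          partner (partner (encode (v , i))) ≡⟨ cong partner eq ⟩
          partner (encode (v′ , i))        ≡⟨ agrees-backward v′ backward ⟩
          encode (mate (v′ , i))           ≡⟨ cong (λ b → encode (v′ , step b i)) backward ⟩
          encode (v′ , step true i)        ≡⟨ cong (encode ∘ (v′ ,_)) (prev-unique (proj₂ (prev i)) hi) ⟩
          encode (v′ , h)                  ∎
          where open ≡-Reasoning

      agrees : ∀ v → Agrees (v , i)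
      agrees v = by-class (class (v , i)) refl
        where
        by-class : ∀ b → class (v , i) ≡ b → Agrees (v , i)
        by-class true  eq = agrees-backward v eq
        by-class false eq = partner-cases v eq (decode (partner (encode (v , i))))
          (subst (_~ decode (partner (encode (v , i)))) (decode-encode (v , i)) (partner-adj (encode (v , i))))
          (sym (encode-decode _))

    -- The induction climbs from layer 0 to the last layer without stepping across the seam of the
    -- cycle.
    agrees-below : ∀ t i → toℕ i ≡ t → ∀ v → Agrees (v , i)
    agrees-below zero i i≡0 v =
      subst (λ j → Agrees (v , j)) (toℕ-injective (trans toℕ-layer₀ (sym i≡0))) (agrees-layer₀ v)
    agrees-below (suc t) i i≡1+t with prev i
    ... | h , hi@(inj₁ i≡1+h) = Layer.agrees hi
      (λ { refl → ℕ.1+n≢n (sym i≡1+h) })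
      (agrees-below t h (ℕ.suc-injective (trans (sym i≡1+h) i≡1+t)))
    ... | h , inj₂ (_ , i≡0) with () ← trans (sym i≡0) i≡1+t

    forced : M′ ≡ matching
    forced = matching-unique ν ν-adj ν-involutive M′ pm′ λ x →
      trans (cong partner (sym (encode-decode x))) (agrees-below _ (proj₂ (decode x)) refl (proj₁ (decode x)))

  S₀-forcing : ForcingSet H matching S₀
  S₀-forcing = (λ {e} e∈ → let v , e≡ = ∈-tabulate⁻ (∈-fromList⁻ (List.tabulate layer₀-edge) e∈) in
      subst (_∈ matching) (sym e≡) (ν⇒∈ (proj₂ (edge-of (encode (v , layer₀)))) refl))
    , Forced.forced

theorem2p1 : ∀ {c ℓ₁ ℓ₂} (F : HeytingField c ℓ₁ ℓ₂) (n : ℕ) (G : Graph n) →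
    Bipartite G →
    (k : ℕ) (2≤k : 2 ≤ k) →
    ∃ (𝓘 F G) →
    IsMinForcingNumber (G □ cycle (2 * k) (3≤2* 2≤k)) n
theorem2p1 F n G G-bip k 2≤k (A , A∈𝓘) =
  -- One lower bound serves three times: for the size of `S₀`, for its minimality among forcing sets
  -- of `matching`, and for all other perfect matchings.
  ( matching , matching-perfect
  , (S₀ , S₀-forcing , ℕ.≤-antisym ∣S₀∣≤n (lower matching-perfect S₀-forcing))
  , λ { _ (S , forcing , refl) → lower matching-perfect forcing })
  , λ { _ (M , pm , (S , forcing , refl) , _) → lower pm forcing }
  where
  open Prism G G-bip (3≤2* 2≤k) (parity-double k)
  open Matchings.OfInvolution H ν ν-adj ν-involutive using (matching; matching-perfect)
  lower : ∀ {M S} → PerfectMatching H M → ForcingSet H M S → n ≤ ∣ S ∣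
  lower = forcing-set-large F A∈𝓘 (colouring 2≤k)
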